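{- For every positive integer $n\equiv 2\pmod 4$, there exists a near-omniversal Latin square of order $n$.
   Context: A Latin square of order $n$ is an $n\times n$ array on $n$ symbols in which each row and each column contains each symbol exactly once; it is viewed as the set of triples $(r,c,s)$ where $s$ is the symbol in cell $(r,c)$. A partial transversal is a set of triples containing at most one triple in each row, at most one in each column, and at most one with each symbol; its length is its number of triples. It is maximal if it is not contained in a partial transversal of greater length. A Latin square of order $n$ is near-omniversal if, among the integers $\ell$ with $\lceil n/2\rceil\le\ell\le n$, there is exactly one for which it has no maximal partial transversal of length $\ell$. -}

module Defs where

open import Data.Nat using (ℕ; _≤_; _<_; ⌈_/2⌉)
open import Data.Fin using (Fin)
open import Data.Product using (_×_; _,_; proj₁; proj₂; ∃; ∃-syntax; Σ-syntax)
open import Relation.Binary.PropositionalEquality using (_≡_)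
open import Relation.Nullary using (¬_)

Square : ℕ → Set
Square n = Fin n → Fin n → Fin n

IsLatinSquare : {n : ℕ} → Square n → Set
IsLatinSquare {n} L =
  (∀ (r s : Fin n) → ∃[ c ] (L r c ≡ s × ∀ c′ → L r c′ ≡ s → c′ ≡ c)) ×
  (∀ (c s : Fin n) → ∃[ r ] (L r c ≡ s × ∀ r′ → L r′ c ≡ s → r′ ≡ r))

-- A cell (r , c); the triple it determines is (r , c , L r c).
Cell : ℕ → Set
Cell n = Fin n × Fin n

-- A set of ℓ triples of L, listed by an indexing f : Fin ℓ → cells, is a partial
-- transversal (of length ℓ) when distinct indices never share a row, a column,
-- or a symbol (in particular the ℓ triples are distinct).
IsPartialTransversal : {n : ℕ} → Square n → {ℓ : ℕ} → (Fin ℓ → Cell n) → Set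
IsPartialTransversal {n} L {ℓ} f =
  (∀ i j → proj₁ (f i) ≡ proj₁ (f j) → i ≡ j) ×
  (∀ i j → proj₂ (f i) ≡ proj₂ (f j) → i ≡ j) ×
  (∀ i j → L (proj₁ (f i)) (proj₂ (f i)) ≡ L (proj₁ (f j)) (proj₂ (f j)) → i ≡ j)

IsMaximalPartialTransversal : {n : ℕ} → Square n → {ℓ : ℕ} → (Fin ℓ → Cell n) → Set
IsMaximalPartialTransversal {n} L {ℓ} f =
  IsPartialTransversal L f ×
  ¬ (∃[ m ] Σ[ g ∈ (Fin m → Cell n) ]
       (IsPartialTransversal L g × ℓ < m × (∀ i → ∃[ j ] (g j ≡ f i))))

HasMaximalPartialTransversalOfLength : {n : ℕ} → Square n → ℕ → Set
HasMaximalPartialTransversalOfLength {n} L ℓ =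
  Σ[ f ∈ (Fin ℓ → Cell n) ] IsMaximalPartialTransversal L f

IsNearOmniversal : {n : ℕ} → Square n → Set
IsNearOmniversal {n} L =
  ∃[ ℓ ] (⌈ n /2⌉ ≤ ℓ × ℓ ≤ n × ¬ HasMaximalPartialTransversalOfLength L ℓ ×
          (∀ k → ⌈ n /2⌉ ≤ k → k ≤ n → ¬ HasMaximalPartialTransversalOfLength L k → k ≡ ℓ))

{-# OPTIONS --safe #-}
module Submission where

-- Write n = 2k with k = 2q + 1 and q ≥ 1 (for q = 0 the table of ℤ₂ works). Take the Cayley table of
-- ℤ_k × ℤ₂ and switch one intercalate, so that L((i,α),(j,β)) = (i + j, α + β + [i = 2q and j = q]).
--
-- No maximal partial transversal has length k: one would split the rows, columns and symbols into used
-- and unused halves for which L maps onto the table of ℤ₂. Off the switched cells such a homotopy to ℤ₂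
-- factors either through ℤ_k, where it is constant because k is odd, or is the projection to ℤ₂ up to
-- translation, which the switched cells contradict.
--
-- For every m ≤ q the cells ((i,α),(i,α)) with α = [i ≥ m], together with ((q+b+t,0),(t,1)) and
-- ((t,1),(q+b′+t,0)) for t < m, where {b,b′} = {0,1}, form a partial transversal of length k + 2m that
-- uses all rows (_,1), all columns (_,1) and all symbols (_,0); hence only the switched cell
-- ((2q,0),(q,0)) could extend it. For b = 1 and m ≥ 1 column (q,0) is already used; for b = 0 that cell
-- can be added, which gives length k + 2m + 1.

open import Defs
open import Data.Nat using (ℕ; zero; suc; _+_; _*_; _∸_; _≤_; _<_; _%_; _/_; z≤n; s≤s; ⌈_/2⌉; _≤?_)
open import Data.Nat.Properties as ℕ using (≤-trans; <-≤-trans; <⇒≤; <⇒≢; m≤m+n; +-assoc; +-comm; +-suc; +-identityʳ; *-comm; m+[n∸m]≡n; m∸n+n≡m; n≡⌈n+n/2⌉)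
open import Data.Nat.DivMod using (_mod_; m%n<n; m<n⇒m%n≡m; %-distribˡ-+; [m+n]%n≡m%n; [m+kn]%n≡m%n; m≡m%n+[m/n]*n)
open import Data.Nat.Tactic.RingSolver using (solve-∀)
open import Data.Bool using (Bool; true; false; not; _xor_; _∧_)
open import Data.Bool.Properties using (xor-assoc; xor-comm; xor-same; ∧-zeroʳ; not-injective)
open import Data.Fin using (Fin; zero; suc; toℕ; fromℕ<; punchOut; splitAt; join)
open import Data.Fin.Properties using (any?; injective⇒≤; punchOut-injective; toℕ<n; toℕ-injective; toℕ-fromℕ<; splitAt-join; +↔⊎; *↔×; 1↔⊤; 2↔Bool) renaming (_≟_ to _≟ᶠ_)
open import Data.Product using (_×_; _,_; proj₁; proj₂; ∃-syntax; Σ-syntax; uncurry)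
open import Data.Product.Function.NonDependent.Propositional using (_×-↔_)
open import Data.Sum as Sum using (_⊎_; inj₁; inj₂; [_,_]′)
open import Data.Sum.Function.Propositional using (_⊎-↔_)
open import Data.Unit using (⊤; tt)
open import Function using (_∘_; flip; case_of_)
open import Function.Bundles using (_↔_; module Inverse)
open import Function.Construct.Composition using (_↔-∘_)
open import Function.Construct.Identity using (↔-id)
open import Function.Definitions using (Injective)
open import Relation.Binary.PropositionalEquality using (_≡_; _≢_; refl; sym; trans; cong; cong₂; subst; module ≡-Reasoning)
open import Relation.Nullary using (¬_; Dec; yes; no; does; contradiction; _⊎-dec_; ¬?)
open import Relation.Nullary.Decidable using (dec-true; dec-false; decidable-stable)

-- Finite injections and Latin squares

Inj : {A B : Set} → (A → B) → Set
Inj = Injective _≡_ _≡_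

injective⇒surjective : ∀ {n} {f : Fin n → Fin n} → Inj f → ∀ y → ∃[ x ] f x ≡ y
injective⇒surjective {suc n} {f} f-inj y with any? (λ x → f x ≟ᶠ y)
... | yes hit = hit
... | no miss = contradiction (injective⇒≤ g-inj) ℕ.1+n≰n
  where
  y≢f : ∀ x → y ≢ f x
  y≢f x y≡fx = miss (x , sym y≡fx)
  g : Fin (suc n) → Fin n
  g x = punchOut (y≢f x)
  g-inj : Inj g
  g-inj {a} {b} eq = f-inj (punchOut-injective (y≢f a) (y≢f b) eq)

cancellative⇒latin : ∀ {n} (L : Square n) → (∀ r → Inj (L r)) → (∀ c → Inj (flip L c)) → IsLatinSquare L
cancellative⇒latin L rows cols =
  (λ r s → case injective⇒surjective (rows r) s of λ { (c , eq) → c , eq , λ c′ eq′ → rows r (trans eq′ (sym eq)) }) ,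
  (λ c s → case injective⇒surjective (cols c) s of λ { (r , eq) → r , eq , λ r′ eq′ → cols c (trans eq′ (sym eq)) })

[,]-inj : {A B C : Set} {f : A → C} {g : B → C} → Inj f → Inj g → (∀ x y → f x ≢ g y) → Inj [ f , g ]′
[,]-inj f-inj g-inj f≢g {inj₁ x} {inj₁ y} e = cong inj₁ (f-inj e)
[,]-inj f-inj g-inj f≢g {inj₁ x} {inj₂ y} e = contradiction e (f≢g x y)
[,]-inj f-inj g-inj f≢g {inj₂ x} {inj₁ y} e = contradiction (sym e) (f≢g y x)
[,]-inj f-inj g-inj f≢g {inj₂ x} {inj₂ y} e = cong inj₂ (g-inj e)

-- Maximality tested on single cells

Meets : ∀ {n} → Square n → {ℓ : ℕ} → (Fin ℓ → Cell n) → Set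
Meets L f = ∀ r c → ∃[ i ] (proj₁ (f i) ≡ r ⊎ proj₂ (f i) ≡ c ⊎ uncurry L (f i) ≡ L r c)

-- Every cell of an extension `g` conflicts with some cell of `f`, which also belongs to `g`; since
-- `g` is a partial transversal, the two coincide. So `g` injects into the indices of `f` and cannot
-- be longer.
meets⇒maximal : ∀ {n} {L : Square n} {ℓ} {f : Fin ℓ → Cell n} →
  IsPartialTransversal L f → Meets L f → IsMaximalPartialTransversal L f
meets⇒maximal {n} {L} {ℓ} {f} pt meets = pt , λ { (m , g , (gr , gc , gs) , ℓ<m , f⊆g) →
  let
    back : ∀ j → ∃[ i ] f i ≡ g j
    back j = case meets (proj₁ (g j)) (proj₂ (g j)) of λ
      { (i , p) → let (j′ , gj′≡fi) = f⊆g i in i , trans (sym gj′≡fi) (cong g (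
          [ (λ e → gr j′ j (trans (cong proj₁ gj′≡fi) e))
          , [ (λ e → gc j′ j (trans (cong proj₂ gj′≡fi) e))
            , (λ e → gs j′ j (trans (cong (uncurry L) gj′≡fi) e)) ]′ ]′ p)) }
    back-inj : Inj (proj₁ ∘ back)
    back-inj {a} {b} eq = gr a b (cong proj₁
      (trans (sym (proj₂ (back a))) (trans (cong f eq) (proj₂ (back b)))))
  in contradiction (injective⇒≤ back-inj) (ℕ.<⇒≱ ℓ<m) }

-- A cell in conflict with nothing could be prepended to `f`.
maximal⇒meets : ∀ {n} {L : Square n} {ℓ} {f : Fin ℓ → Cell n} →
  IsMaximalPartialTransversal L f → Meets L f
maximal⇒meets {n} {L} {ℓ} {f} ((fr , fc , fs) , maximal) r c
  with any? (λ i → (proj₁ (f i) ≟ᶠ r) ⊎-dec ((proj₂ (f i) ≟ᶠ c) ⊎-dec (uncurry L (f i) ≟ᶠ L r c)))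
... | yes met = met
... | no unmet = contradiction
        (suc ℓ , g , (injective proj₁ (λ i e → unmet (i , inj₁ e)) fr ,
                      injective proj₂ (λ i e → unmet (i , inj₂ (inj₁ e))) fc ,
                      injective (uncurry L) (λ i e → unmet (i , inj₂ (inj₂ e))) fs) ,
         ℕ.n<1+n ℓ , λ i → suc i , refl)
        maximal
  where
  g : Fin (suc ℓ) → Cell n
  g zero    = r , c
  g (suc i) = f i
  injective : (π : Cell n → Fin n) → (∀ i → π (f i) ≢ π (r , c)) →
    (∀ i j → π (f i) ≡ π (f j) → i ≡ j) → ∀ i j → π (g i) ≡ π (g j) → i ≡ j
  injective π new old zero    zero    _ = refl
  injective π new old zero    (suc j) e = contradiction (sym e) (new j)
  injective π new old (suc i) zero    e = contradiction e (new i)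
  injective π new old (suc i) (suc j) e = cong suc (old i j e)

-- Partial transversals of half length

Hit : ∀ {k n} → (Fin k → Fin n) → Fin n → Set
Hit p x = ∃[ i ] p i ≡ x

hit? : ∀ {k n} (p : Fin k → Fin n) x → Dec (Hit p x)
hit? p x = any? (λ i → p i ≟ᶠ x)

-- Counting: each of the 2k points takes a label from the k indices of `p` and the k indices of `s`,
-- and a label determines its point. So every label is taken exactly once, whereas a point hit on
-- both sides would own two.
either⇒not-both : ∀ {k n} → n ≡ k + k → {φ : Fin n → Fin n} → Inj φ → {p s : Fin k → Fin n} →
  (∀ x → Hit p x ⊎ Hit s (φ x)) → ∀ x → Hit p x → ¬ Hit s (φ x)
either⇒not-both {k} refl {φ} φ-inj {p} {s} cover x (i , pi≡x) (j , sj≡φx) =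
  case trans (sym label-x≡i) label-x≡j of λ ()
  where
  label : ∀ {x} → Hit p x ⊎ Hit s (φ x) → Fin k ⊎ Fin k
  label = Sum.map proj₁ proj₁
  label-inj : ∀ {x y} (u : Hit p x ⊎ Hit s (φ x)) (v : Hit p y ⊎ Hit s (φ y)) → label u ≡ label v → x ≡ y
  label-inj (inj₁ (_ , e)) (inj₁ (_ , e′)) refl = trans (sym e) e′
  label-inj (inj₂ (_ , e)) (inj₂ (_ , e′)) refl = φ-inj (trans (sym e) e′)
  join-inj : ∀ {u v} → join k k u ≡ join k k v → u ≡ v
  join-inj {u} {v} e = trans (sym (splitAt-join k k u)) (trans (cong (splitAt k) e) (splitAt-join k k v))
  g-inj : Inj (λ x → join k k (label (cover x)))
  g-inj {a} {b} e = label-inj (cover a) (cover b) (join-inj e)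
  attained : (w : Hit p x ⊎ Hit s (φ x)) → label (cover x) ≡ label w
  attained w with injective⇒surjective g-inj (join k k (label w))
  ... | a , e with join-inj {label (cover a)} {label w} e
  ...   | e′ with label-inj (cover a) w e′
  ...     | refl = e′
  label-x≡i : label (cover x) ≡ inj₁ i
  label-x≡i = attained (inj₁ (i , pi≡x))
  label-x≡j : label (cover x) ≡ inj₂ j
  label-x≡j = attained (inj₂ (j , sj≡φx))

-- Replace `φ` on the image of `p` by the matching values of `s`. The result is still injective,
-- hence onto; a point over `φ x` cannot lie outside the image of `p`, as it would then be `x`
-- itself, so `φ x` is a value of `s`.
avoids⇒hits : ∀ {k n} {φ : Fin n → Fin n} → Inj φ → {p s : Fin k → Fin n} → Inj p → Inj s →
  (∀ x → ¬ Hit p x → ¬ Hit s (φ x)) → ∀ x → Hit p x → Hit s (φ x)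
avoids⇒hits {k} {n} {φ} φ-inj {p} {s} p-inj s-inj avoids x hx
  with injective⇒surjective g-inj (φ x)
  where
  g′ : ∀ x → Dec (Hit p x) → Fin n
  g′ x (yes (i , _)) = s i
  g′ x (no _)        = φ x
  g′-inj : ∀ {x y} (u : Dec (Hit p x)) (v : Dec (Hit p y)) → g′ x u ≡ g′ y v → x ≡ y
  g′-inj (yes (i , e)) (yes (j , e′)) eq = trans (sym e) (trans (cong p (s-inj eq)) e′)
  g′-inj (yes (i , _)) (no ¬h)        eq = contradiction (i , eq) (avoids _ ¬h)
  g′-inj (no ¬h)       (yes (j , _))  eq = contradiction (j , sym eq) (avoids _ ¬h)
  g′-inj (no _)        (no _)         eq = φ-inj eq
  g-inj : Inj (λ x → g′ x (hit? p x))
  g-inj {a} {b} = g′-inj (hit? p a) (hit? p b)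
... | y , e with hit? p y
...   | yes (i , _) = i , e
...   | no ¬h       = contradiction (subst (Hit p) (sym (φ-inj e)) hx) ¬h

does-xnor : {A B C : Set} (a : Dec A) (b : Dec B) (c : Dec C) →
  (A → B → C) → (A → ¬ B → ¬ C) → (¬ A → B → ¬ C) → (¬ A → ¬ B → C) → does c ≡ does a xor not (does b)
does-xnor (yes a) (yes b) c in-in in-out out-in out-out = dec-true c (in-in a b)
does-xnor (yes a) (no b)  c in-in in-out out-in out-out = dec-false c (in-out a b)
does-xnor (no a)  (yes b) c in-in in-out out-in out-out = dec-false c (out-in a b)
does-xnor (no a)  (no b)  c in-in in-out out-in out-out = dec-true c (out-out a b)

-- A maximal partial transversal of half length forces the used rows × used columns, and the
-- unused rows × unused columns, to carry exactly the used symbols.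
half-maximal⇒homotopy : ∀ {k n} → n ≡ suc k + suc k → {L : Square n} →
  (∀ r → Inj (L r)) → (∀ c → Inj (flip L c)) → HasMaximalPartialTransversalOfLength L (suc k) →
  Σ[ ρ ∈ (Fin n → Bool) ] Σ[ γ ∈ (Fin n → Bool) ] Σ[ σ ∈ (Fin n → Bool) ]
    ((∀ r c → σ (L r c) ≡ ρ r xor γ c) × (∃[ r ] ρ r ≡ true) × (∃[ r ] ρ r ≡ false))
half-maximal⇒homotopy {k} {n} n≡ {L} L-injʳ L-injˡ (f , max@((row-inj , col-inj , sym-inj) , _)) =
  does ∘ hit? row , not ∘ does ∘ hit? col , does ∘ hit? symb , homotopy ,
  (row zero , dec-true (hit? row _) (zero , refl)) , unused
  where
  row col symb : Fin (suc k) → Fin n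
  row  = proj₁ ∘ f
  col  = proj₂ ∘ f
  symb = uncurry L ∘ f
  out-out : ∀ r c → ¬ Hit row r → ¬ Hit col c → Hit symb (L r c)
  out-out r c ¬r ¬c with maximal⇒meets max r c
  ... | i , inj₁ e        = contradiction (i , e) ¬r
  ... | i , inj₂ (inj₁ e) = contradiction (i , e) ¬c
  ... | i , inj₂ (inj₂ e) = i , e
  out-in : ∀ r c → ¬ Hit row r → Hit col c → ¬ Hit symb (L r c)
  out-in r c ¬r = either⇒not-both n≡ (L-injʳ r) cover c
    where
    cover : ∀ x → Hit col x ⊎ Hit symb (L r x)
    cover x with hit? col x
    ... | yes h = inj₁ h
    ... | no ¬h = inj₂ (out-out r x ¬r ¬h)
  in-out : ∀ r c → Hit row r → ¬ Hit col c → ¬ Hit symb (L r c)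
  in-out r c hr ¬c = either⇒not-both n≡ (L-injˡ c) cover r hr
    where
    cover : ∀ x → Hit row x ⊎ Hit symb (L x c)
    cover x with hit? row x
    ... | yes h = inj₁ h
    ... | no ¬h = inj₂ (out-out x c ¬h ¬c)
  in-in : ∀ r c → Hit row r → Hit col c → Hit symb (L r c)
  in-in r c hr hc = avoids⇒hits (L-injˡ c) (row-inj _ _) (sym-inj _ _) (λ x ¬x → out-in x c ¬x hc) r hr
  homotopy : ∀ r c → does (hit? symb (L r c)) ≡ does (hit? row r) xor not (does (hit? col c))
  homotopy r c = does-xnor (hit? row r) (hit? col c) (hit? symb (L r c))
    (in-in r c) (in-out r c) (out-in r c) (out-out r c)
  unused : ∃[ r ] does (hit? row r) ≡ false
  unused with any? (λ r → ¬? (hit? row r))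
  ... | yes (r , ¬h) = r , dec-false (hit? row r) ¬h
  ... | no all = contradiction (injective⇒≤ index-inj) (ℕ.<⇒≱ (subst (suc k <_) (sym n≡) (ℕ.m<m+n (suc k) (s≤s z≤n))))
    where
    index : ∀ r → Hit row r
    index r = decidable-stable (hit? row r) (λ ¬h → all (r , ¬h))
    index-inj : Inj (proj₁ ∘ index)
    index-inj {a} {b} e = trans (sym (proj₂ (index a))) (trans (cong row e) (proj₂ (index b)))

-- Arithmetic in ℤ_k for odd k

module Residues (q : ℕ) where

  k : ℕ
  k = suc (q + q)

  [_] : ℕ → Fin k
  [ x ] = x mod k

  toℕ-[] : ∀ x → toℕ [ x ] ≡ x % k
  toℕ-[] x = toℕ-fromℕ< (m%n<n x k)

  []-cong : ∀ x y → x % k ≡ y % k → [ x ] ≡ [ y ]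
  []-cong x y e = toℕ-injective (trans (toℕ-[] x) (trans e (sym (toℕ-[] y))))

  toℕ-[]-small : ∀ {x} → x < k → toℕ [ x ] ≡ x
  toℕ-[]-small {x} x<k = trans (toℕ-[] x) (m<n⇒m%n≡m x<k)

  []-injective : ∀ {x y} → x < k → y < k → [ x ] ≡ [ y ] → x ≡ y
  []-injective x<k y<k e = trans (sym (toℕ-[]-small x<k)) (trans (cong toℕ e) (toℕ-[]-small y<k))

  []-toℕ : ∀ i → [ toℕ i ] ≡ i
  []-toℕ i = toℕ-injective (toℕ-[]-small (toℕ<n i))

  infixl 6 _⊕_
  _⊕_ : Fin k → Fin k → Fin k
  i ⊕ j = [ toℕ i + toℕ j ]

  []-⊕ : ∀ x y → [ x ] ⊕ [ y ] ≡ [ x + y ]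
  []-⊕ x y = []-cong (toℕ [ x ] + toℕ [ y ]) (x + y)
    (trans (cong₂ (λ a b → (a + b) % k) (toℕ-[] x) (toℕ-[] y)) (sym (%-distribˡ-+ x y k)))

  ⊕-comm : ∀ i j → i ⊕ j ≡ j ⊕ i
  ⊕-comm i j = cong [_] (+-comm (toℕ i) (toℕ j))

  ⊖_ : Fin k → Fin k
  ⊖ i = [ k ∸ toℕ i ]

  ⊕-cancel : ∀ i j → ⊖ i ⊕ (i ⊕ j) ≡ j
  ⊕-cancel i j = begin
    ⊖ i ⊕ (i ⊕ j)                        ≡⟨ []-⊕ (k ∸ toℕ i) (toℕ i + toℕ j) ⟩
    [ (k ∸ toℕ i) + (toℕ i + toℕ j) ]    ≡⟨ cong [_] (sym (+-assoc (k ∸ toℕ i) (toℕ i) (toℕ j))) ⟩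
    [ (k ∸ toℕ i) + toℕ i + toℕ j ]      ≡⟨ cong (λ z → [ z + toℕ j ]) (m∸n+n≡m (<⇒≤ (toℕ<n i))) ⟩
    [ k + toℕ j ]                        ≡⟨ cong [_] (+-comm k (toℕ j)) ⟩
    [ toℕ j + k ]                        ≡⟨ []-cong (toℕ j + k) (toℕ j) ([m+n]%n≡m%n (toℕ j) k) ⟩
    [ toℕ j ]                            ≡⟨ []-toℕ j ⟩
    j                                    ∎
    where open ≡-Reasoning

  ⊕-injʳ : ∀ i → Inj (i ⊕_)
  ⊕-injʳ i {a} {b} e = trans (sym (⊕-cancel i a)) (trans (cong (⊖ i ⊕_) e) (⊕-cancel i b))

  ⊕-injˡ : ∀ j → Inj (_⊕ j)
  ⊕-injˡ j {a} {b} e = ⊕-injʳ j (trans (⊕-comm j a) (trans e (⊕-comm b j)))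

  ⊕-surjʳ : ∀ i s → ∃[ j ] i ⊕ j ≡ s
  ⊕-surjʳ i = injective⇒surjective (⊕-injʳ i)

  double-surj : ∀ s → ∃[ i ] i ⊕ i ≡ s
  -- q + 1 is the inverse of 2 modulo k, because 2(q + 1) = k + 1.
  double-surj s = [ suc q * toℕ s ] , (begin
    [ suc q * toℕ s ] ⊕ [ suc q * toℕ s ]  ≡⟨ []-⊕ (suc q * toℕ s) (suc q * toℕ s) ⟩
    [ suc q * toℕ s + suc q * toℕ s ]      ≡⟨ cong [_] (halves q (toℕ s)) ⟩
    [ toℕ s + toℕ s * k ]                  ≡⟨ []-cong (toℕ s + toℕ s * k) (toℕ s) ([m+kn]%n≡m%n (toℕ s) (toℕ s) k) ⟩
    [ toℕ s ]                              ≡⟨ []-toℕ s ⟩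
    s                                      ∎)
    where
    open ≡-Reasoning
    halves : ∀ q s → suc q * s + suc q * s ≡ s + s * suc (q + q)
    halves = solve-∀

  -- Halving is injective because doubling undoes it, so it is onto; on values of halving, doubling
  -- is visibly injective.
  double-inj : Inj (λ i → i ⊕ i)
  double-inj {i} {j} e
    with injective⇒surjective half-inj i | injective⇒surjective half-inj j
    where
    half-inj : Inj (proj₁ ∘ double-surj)
    half-inj {a} {b} e = trans (sym (proj₂ (double-surj a))) (trans (cong (λ i → i ⊕ i) e) (proj₂ (double-surj b)))
  ... | a , refl | b , refl = cong (proj₁ ∘ double-surj)
    (trans (sym (proj₂ (double-surj a))) (trans e (proj₂ (double-surj b))))

-- Addition in ℤ₂

xor-cancelˡ : ∀ a {b c} → a xor b ≡ a xor c → b ≡ c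
xor-cancelˡ false e = e
xor-cancelˡ true  e = not-injective e

xor-cancelʳ : ∀ {a b} c → a xor c ≡ b xor c → a ≡ b
xor-cancelʳ {a} {b} c e = xor-cancelˡ c (trans (xor-comm c a) (trans e (xor-comm b c)))

-- Signs do not matter in ℤ₂. This turns equal sums of a row value and a column value into equal
-- differences of row values and column values.
xor-exchange : ∀ a b c d → a xor b ≡ c xor d → a xor c ≡ b xor d
xor-exchange false false false d     e  = e
xor-exchange false false true  false ()
xor-exchange false false true  true  e  = refl
xor-exchange false true  false d     e  = cong not e
xor-exchange false true  true  d     e  = e
xor-exchange true  false false d     e  = e
xor-exchange true  false true  false e  = refl
xor-exchange true  false true  true  ()
xor-exchange true  true  false d     e  = cong not e
xor-exchange true  true  true  d     e  = e

xor-translate : ∀ a b c → (a xor c) xor (b xor c) ≡ a xor b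
xor-translate a b c = xor-exchange (a xor c) a (b xor c) b
  (trans (xor-comm (a xor c) a) (trans (cancel a c) (sym (trans (xor-comm (b xor c) b) (cancel b c)))))
  where
  cancel : ∀ a c → a xor (a xor c) ≡ c
  cancel a c = trans (sym (xor-assoc a a c)) (cong (_xor c) (xor-same a))

xor-fixed : ∀ a {d} → a ≡ a xor d → d ≡ false
xor-fixed false e = sym e
xor-fixed true  e = not-injective (sym e)

-- The table of ℤ_k × ℤ₂ with one intercalate switched

module Switched (p : ℕ) where

  -- Building in q ≥ 1 keeps rows 0, 1 and 2q - 1 apart from the switched row 2q, and column 0 apart
  -- from the switched column q.
  q : ℕ
  q = suc p

  open Residues q

  X : Set
  X = Fin k × Bool

  -- Rows (2q, _) and columns (q, _) span a 2 × 2 subsquare; flipping the ℤ₂ part there exchanges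
  -- its two symbols.
  switched : Fin k → Fin k → Bool
  switched i j = does (i ≟ᶠ [ q + q ]) ∧ does (j ≟ᶠ [ q ])

  switched-row : ∀ {i} j → i ≢ [ q + q ] → switched i j ≡ false
  switched-row {i} j i≢ = cong (_∧ does (j ≟ᶠ [ q ])) (dec-false (i ≟ᶠ [ q + q ]) i≢)

  switched-col : ∀ i {j} → j ≢ [ q ] → switched i j ≡ false
  switched-col i {j} j≢ = trans (cong (does (i ≟ᶠ [ q + q ]) ∧_) (dec-false (j ≟ᶠ [ q ]) j≢)) (∧-zeroʳ _)

  switched-cell : switched [ q + q ] [ q ] ≡ true
  switched-cell = cong₂ _∧_ (dec-true ([ q + q ] ≟ᶠ [ q + q ]) refl) (dec-true ([ q ] ≟ᶠ [ q ]) refl)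

  infixl 6 _∙_
  _∙_ : X → X → X
  (i , α) ∙ (j , β) = i ⊕ j , switched i j xor (α xor β)

  ∙-injʳ : ∀ r → Inj (r ∙_)
  ∙-injʳ (i , α) {j , β} {j′ , β′} e with ⊕-injʳ i {j} {j′} (cong proj₁ e)
  ... | refl = cong (j ,_) (xor-cancelˡ α (xor-cancelˡ (switched i j) (cong proj₂ e)))

  ∙-injˡ : ∀ c → Inj (_∙ c)
  ∙-injˡ (j , β) {i , α} {i′ , α′} e with ⊕-injˡ j {i} {i′} (cong proj₁ e)
  ... | refl = cong (i ,_) (xor-cancelʳ β (xor-cancelˡ (switched i j) (cong proj₂ e)))

  q<k : q < k
  q<k = s≤s (m≤m+n q q)

  0≢2q : [ 0 ] ≢ [ q + q ]
  0≢2q e = case []-injective (s≤s z≤n) (ℕ.n<1+n (q + q)) e of λ ()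

  1≢2q : [ 1 ] ≢ [ q + q ]
  1≢2q e = case trans (cong (_∸ 1) ([]-injective (s≤s (s≤s z≤n)) (ℕ.n<1+n (q + q)) e)) (+-suc p p) of λ ()

  q+p≢2q : [ q + p ] ≢ [ q + q ]
  q+p≢2q e = <⇒≢ q+p<2q ([]-injective (≤-trans q+p<2q (ℕ.n≤1+n (q + q))) (ℕ.n<1+n (q + q)) e)
    where
    q+p<2q : q + p < q + q
    q+p<2q = ℕ.+-monoʳ-< q (ℕ.n<1+n p)

  0≢q : [ 0 ] ≢ [ q ]
  0≢q e = case []-injective (s≤s z≤n) q<k e of λ ()

  -- Homotopies to ℤ₂ are constant on rows

  module _ {ρ γ σ : X → Bool} (homotopy : ∀ r c → σ (r ∙ c) ≡ ρ r xor γ c) where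

    -- The variation of `f` along the fibre over `i`; it vanishes identically exactly when `f`
    -- factors through ℤ_k.
    Δ : (X → Bool) → Fin k → Bool
    Δ f i = f (i , false) xor f (i , true)

    Δ-shift : ∀ f i s → f (i , s xor false) xor f (i , s xor true) ≡ Δ f i
    Δ-shift f i false = refl
    Δ-shift f i true  = xor-comm (f (i , true)) (f (i , false))

    -- In column (j, 0) the two rows over `i` carry the two symbols over `i ⊕ j`, in an order that
    -- `Δ-shift` makes irrelevant, and the common column value cancels.
    Δσ≡Δρ : ∀ i j → Δ σ (i ⊕ j) ≡ Δ ρ i
    Δσ≡Δρ i j = trans (sym (Δ-shift σ (i ⊕ j) (switched i j)))
      (trans (cong₂ _xor_ (homotopy (i , false) (j , false)) (homotopy (i , true) (j , false)))
             (xor-translate (ρ (i , false)) (ρ (i , true)) (γ (j , false))))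

    Δρ-const : ∀ i → Δ ρ i ≡ Δ σ [ 0 ]
    Δρ-const i = case ⊕-surjʳ i [ 0 ] of λ { (j , e) → trans (sym (Δσ≡Δρ i j)) (cong (Δ σ) e) }

    Δσ-const : ∀ s → Δ σ s ≡ Δ σ [ 0 ]
    Δσ-const s = case ⊕-surjʳ [ 0 ] s of λ { (j , e) →
      trans (cong (Δ σ) (sym e)) (trans (Δσ≡Δρ [ 0 ] j) (Δρ-const [ 0 ])) }

    ρ₀ γ₀ σ₀ : ℕ → Bool
    ρ₀ x = ρ ([ x ] , false)
    γ₀ x = γ ([ x ] , false)
    σ₀ x = σ ([ x ] , false)

    plain : ∀ x y → switched [ x ] [ y ] ≡ false → σ₀ (x + y) ≡ ρ₀ x xor γ₀ y
    plain x y s = trans (cong₂ (λ i α → σ (i , α xor false)) (sym ([]-⊕ x y)) (sym s)) (homotopy ([ x ] , false) ([ y ] , false))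

    -- The switched cell carries the other symbol of its fibre, so the rule `plain` is off there by
    -- the constant variation of `σ`.
    at-switched : σ₀ (q + q + q) xor Δ σ [ 0 ] ≡ ρ₀ (q + q) xor γ₀ q
    at-switched = begin
      σ₀ (q + q + q) xor Δ σ [ 0 ]             ≡⟨ cong (σ₀ (q + q + q) xor_) (sym (Δσ-const [ q + q + q ])) ⟩
      σ₀ (q + q + q) xor (σ₀ (q + q + q) xor σ ([ q + q + q ] , true))
        ≡⟨ sym (xor-assoc (σ₀ (q + q + q)) (σ₀ (q + q + q)) _) ⟩
      (σ₀ (q + q + q) xor σ₀ (q + q + q)) xor σ ([ q + q + q ] , true)
        ≡⟨ cong (_xor σ ([ q + q + q ] , true)) (xor-same (σ₀ (q + q + q))) ⟩
      σ ([ q + q + q ] , true)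
        ≡⟨ cong₂ (λ i α → σ (i , α xor false)) (sym ([]-⊕ (q + q) q)) (sym switched-cell) ⟩
      σ (([ q + q ] , false) ∙ ([ q ] , false)) ≡⟨ homotopy _ _ ⟩
      ρ₀ (q + q) xor γ₀ q                      ∎
      where open ≡-Reasoning

    -- Neighbouring cells on an antidiagonal, when unswitched, carry the same symbol.
    slide : ∀ x y → switched [ suc x ] [ y ] ≡ false → switched [ x ] [ suc y ] ≡ false →
      ρ₀ (suc x) xor ρ₀ x ≡ γ₀ y xor γ₀ (suc y)
    slide x y s s′ = xor-exchange (ρ₀ (suc x)) (γ₀ y) (ρ₀ x) (γ₀ (suc y))
      (trans (sym (plain (suc x) y s)) (trans (cong σ₀ (sym (+-suc x y))) (plain x (suc y) s′)))

    -- Sliding around the rectangle with rows {2q-1, 2q} and {0, 1} and columns {q, q+1} and {0, 1}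
    -- meets the switched cell exactly once.
    Δσ-false : Δ σ [ 0 ] ≡ false
    Δσ-false = xor-fixed (ρ₀ (q + p) xor γ₀ (suc q)) (begin
      ρ₀ (q + p) xor γ₀ (suc q)   ≡⟨ sym (xor-exchange (ρ₀ (q + q)) (ρ₀ (q + p)) (γ₀ q) (γ₀ (suc q)) around) ⟩
      ρ₀ (q + q) xor γ₀ q         ≡⟨ sym at-switched ⟩
      σ₀ (q + q + q) xor Δ σ [ 0 ]
        -- Since 3q = (2q - 1) + (q + 1), the symbol (3q, 0) also occurs at an unswitched cell in
        -- row (2q - 1, 0).
        ≡⟨ cong (λ x → σ₀ x xor Δ σ [ 0 ]) (trans (cong (_+ q) (+-suc q p)) (sym (+-suc (q + p) q))) ⟩
      σ₀ (q + p + suc q) xor Δ σ [ 0 ]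
        ≡⟨ cong (_xor Δ σ [ 0 ]) (plain (q + p) (suc q) (switched-row [ suc q ] q+p≢2q)) ⟩
      (ρ₀ (q + p) xor γ₀ (suc q)) xor Δ σ [ 0 ] ∎)
      where
      open ≡-Reasoning
      around : ρ₀ (q + q) xor ρ₀ (q + p) ≡ γ₀ q xor γ₀ (suc q)
      around = begin
        ρ₀ (q + q) xor ρ₀ (q + p)       ≡⟨ cong (λ x → ρ₀ x xor ρ₀ (q + p)) (+-suc q p) ⟩
        ρ₀ (suc (q + p)) xor ρ₀ (q + p) ≡⟨ slide (q + p) 0 (switched-col [ suc (q + p) ] 0≢q) (switched-row [ 1 ] q+p≢2q) ⟩
        γ₀ 0 xor γ₀ 1                   ≡⟨ sym (slide 0 0 (switched-row [ 0 ] 1≢2q) (switched-row [ 1 ] 0≢2q)) ⟩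
        ρ₀ 1 xor ρ₀ 0                   ≡⟨ slide 0 q (switched-row [ q ] 1≢2q) (switched-row [ suc q ] 0≢2q) ⟩
        γ₀ q xor γ₀ (suc q)             ∎

    xor-false⇒≡ : ∀ {a b} → a xor b ≡ false → a ≡ b
    xor-false⇒≡ {a} {b} e = xor-cancelʳ b (trans e (sym (xor-same b)))

    σ-flat : ∀ s α → σ (s , α) ≡ σ (s , false)
    σ-flat s false = refl
    σ-flat s true  = sym (xor-false⇒≡ (trans (Δσ-const s) Δσ-false))

    ρ-flat : ∀ i α → ρ (i , α) ≡ ρ (i , false)
    ρ-flat i false = refl
    ρ-flat i true  = sym (xor-false⇒≡ (trans (Δρ-const i) Δσ-false))

    -- Once `σ` ignores the ℤ₂ coordinate it cannot see the switch, so `plain` extends to all cells.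
    flat : ∀ x y → σ₀ (x + y) ≡ ρ₀ x xor γ₀ y
    flat x y = trans (cong (λ i → σ (i , false)) (sym ([]-⊕ x y)))
      (trans (sym (σ-flat _ _)) (homotopy ([ x ] , false) ([ y ] , false)))

    step : ∀ x → ρ₀ (suc x) xor ρ₀ x ≡ γ₀ 0 xor γ₀ 1
    step x = xor-exchange (ρ₀ (suc x)) (γ₀ 0) (ρ₀ x) (γ₀ 1)
      (trans (sym (flat (suc x) 0)) (trans (cong σ₀ (sym (+-suc x 0))) (flat x 1)))

    -- By `step` all increments of `ρ₀` are equal, so two in a row cancel.
    ρ₀-even : ∀ x → ρ₀ (x + x) ≡ ρ₀ 0
    ρ₀-even zero    = refl
    ρ₀-even (suc x) = begin
      ρ₀ (suc x + suc x)   ≡⟨ cong (ρ₀ ∘ suc) (+-suc x x) ⟩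
      ρ₀ (suc (suc (x + x)))
        ≡⟨ xor-cancelʳ (ρ₀ (suc (x + x))) (trans (step (suc (x + x))) (trans (sym (step (x + x))) (xor-comm (ρ₀ (suc (x + x))) _))) ⟩
      ρ₀ (x + x)           ≡⟨ ρ₀-even x ⟩
      ρ₀ 0                 ∎
      where open ≡-Reasoning

    homotopy⇒constant : ∀ r → ρ r ≡ ρ₀ 0
    homotopy⇒constant (i , α) = trans (ρ-flat i α)
      -- As k is odd, every residue is a double and is reached by `ρ₀-even`.
      (case double-surj i of λ { (h , e) → trans (cong (λ i → ρ (i , false)) (sym e)) (ρ₀-even (toℕ h)) })

  -- Transport to `Fin n`

  n : ℕ
  n = k * 2

  coordinates : Fin n ↔ X
  coordinates = (↔-id (Fin k) ×-↔ 2↔Bool) ↔-∘ *↔×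

  open Inverse coordinates using (to; from; strictlyInverseˡ; strictlyInverseʳ)

  to-inj : Inj to
  to-inj {a} {b} e = trans (sym (strictlyInverseʳ a)) (trans (cong from e) (strictlyInverseʳ b))

  from-inj : Inj from
  from-inj {a} {b} e = trans (sym (strictlyInverseˡ a)) (trans (cong to e) (strictlyInverseˡ b))

  L : Square n
  L r c = from (to r ∙ to c)

  L-injʳ : ∀ r → Inj (L r)
  L-injʳ r e = to-inj (∙-injʳ (to r) (from-inj e))

  L-injˡ : ∀ c → Inj (flip L c)
  L-injˡ c e = to-inj (∙-injˡ (to c) (from-inj e))

  n≡k+k : n ≡ k + k
  n≡k+k = trans (*-comm k 2) (cong (k +_) (+-identityʳ k))

  homotopy⇒constant-rows : {ρ γ σ : Fin n → Bool} → (∀ r c → σ (L r c) ≡ ρ r xor γ c) →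
    ∀ r → ρ r ≡ ρ (from ([ 0 ] , false))
  homotopy⇒constant-rows {ρ} {γ} {σ} homotopy r =
    trans (cong ρ (sym (strictlyInverseʳ r)))
      (homotopy⇒constant {ρ ∘ from} {γ ∘ from} {σ ∘ from} homotopy′ (to r))
    where
    homotopy′ : ∀ r c → σ (from (r ∙ c)) ≡ ρ (from r) xor γ (from c)
    homotopy′ r c = trans (cong (σ ∘ from) (cong₂ _∙_ (sym (strictlyInverseˡ r)) (sym (strictlyInverseˡ c))))
                          (homotopy (from r) (from c))

  no-half-maximal : ¬ HasMaximalPartialTransversalOfLength L k
  no-half-maximal has =
    let ρ , γ , σ , homotopy , (r , ρr≡true) , (r′ , ρr′≡false) =
          half-maximal⇒homotopy {q + q} {n} n≡k+k {L} L-injʳ L-injˡ has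
        constant = homotopy⇒constant-rows {ρ} {γ} {σ} homotopy
    in case trans (sym ρr≡true) (trans (constant r) (trans (sym (constant r′)) ρr′≡false)) of λ ()

  -- Allows a transversal to be described in coordinates over a convenient index type, with
  -- maximality checked one cell at a time.
  realise : ∀ {ℓ} {I : Set} → Fin ℓ ↔ I → (R C : I → X) → Inj R → Inj C → Inj (λ x → R x ∙ C x) →
    (∀ r c → ∃[ x ] (R x ≡ r ⊎ C x ≡ c ⊎ R x ∙ C x ≡ r ∙ c)) → HasMaximalPartialTransversalOfLength L ℓ
  realise {ℓ} {I} index R C R-inj C-inj S-inj meets = f , meets⇒maximal
    ( (λ i j e → at-inj (R-inj (from-inj e)))
    , (λ i j e → at-inj (C-inj (from-inj e)))
    , (λ i j e → at-inj (S-inj (from-inj (trans (sym (L-f i)) (trans e (L-f j)))))) )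
    λ r c → case meets (to r) (to c) of λ { (x , p) → Inverse.from index x ,
      subst (λ y → from (R y) ≡ r ⊎ from (C y) ≡ c ⊎ uncurry L (from (R y) , from (C y)) ≡ L r c)
        (sym (Inverse.strictlyInverseˡ index x))
        (Sum.map (λ e → trans (cong from e) (strictlyInverseʳ r))
          (Sum.map (λ e → trans (cong from e) (strictlyInverseʳ c))
                   (λ e → trans (L-from (R x) (C x)) (cong from e))) p) }
    where
    at : Fin ℓ → I
    at = Inverse.to index
    at-inj : Inj at
    at-inj {i} {j} e = trans (sym (Inverse.strictlyInverseʳ index i))
      (trans (cong (Inverse.from index) e) (Inverse.strictlyInverseʳ index j))
    f : Fin ℓ → Cell n
    f i = from (R (at i)) , from (C (at i))
    L-from : ∀ r c → L (from r) (from c) ≡ from (r ∙ c)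
    L-from r c = cong from (cong₂ _∙_ (strictlyInverseˡ r) (strictlyInverseˡ c))
    L-f : ∀ i → uncurry L (f i) ≡ from (R (at i) ∙ C (at i))
    L-f i = L-from (R (at i)) (C (at i))

  -- The staircase partial transversals

  offset-inj : ∀ {x y} → x < k → y < k → [ q + x ] ≡ [ q + y ] → x ≡ y
  offset-inj {x} {y} x<k y<k e =
    []-injective x<k y<k (⊕-injʳ [ q ] (trans ([]-⊕ q x) (trans e (sym ([]-⊕ q y)))))

  module Staircase (m b b′ : ℕ) (m≤q : m ≤ q) (b≤1 : b ≤ 1) (b′≤1 : b′ ≤ 1)
                   (b≢b′ : ∀ t u → b + 2 * t ≢ b′ + 2 * u) where

    -- Placing the first m diagonal cells at level 0 frees the lines (t, 1) with t < m for `near`,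
    -- and the lines (i, 0) with i ≥ m remain available for `far`.
    diag : Fin k → X
    diag i = i , does (m ≤? toℕ i)

    far : ℕ → Fin m → X
    far b t = [ q + (b + toℕ t) ] , false

    near : Fin m → X
    near t = [ toℕ t ] , true

    far-symbol : ℕ → Fin m → X
    far-symbol b t = [ q + (b + 2 * toℕ t) ] , true

    t<q : (t : Fin m) → toℕ t < q
    t<q t = <-≤-trans (toℕ<n t) m≤q

    t<k : (t : Fin m) → toℕ t < k
    t<k t = ℕ.<-trans (t<q t) q<k

    offset<k : ∀ {b} → b ≤ 1 → (t : Fin m) → b + toℕ t < k
    offset<k b≤1 t = ≤-trans (s≤s (ℕ.+-mono-≤ b≤1 (<⇒≤ (t<q t)))) (s≤s (s≤s (ℕ.m≤n+m q p)))

    -- The bound is 2q and not just k because offset 2q is reserved for the symbol of the switched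
    -- cell in `has-odd-excess`.
    b+2t<2q : ∀ {b} → b ≤ 1 → (t : Fin m) → b + 2 * toℕ t < 2 * q
    b+2t<2q b≤1 t = ≤-trans (s≤s (ℕ.+-monoˡ-≤ (2 * toℕ t) b≤1))
      (≤-trans (ℕ.≤-reflexive (sym (ℕ.*-suc 2 (toℕ t)))) (ℕ.*-monoʳ-≤ 2 (t<q t)))

    2q<k : 2 * q < k
    2q<k = s≤s (ℕ.≤-reflexive (cong (q +_) (+-identityʳ q)))

    b+2t<k : ∀ {b} → b ≤ 1 → (t : Fin m) → b + 2 * toℕ t < k
    b+2t<k b≤1 t = ℕ.<-trans (b+2t<2q b≤1 t) 2q<k

    diag-inj : Inj diag
    diag-inj e = cong proj₁ e

    near-inj : Inj near
    near-inj {t} {u} e = toℕ-injective ([]-injective (t<k t) (t<k u) (cong proj₁ e))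

    far-inj : ∀ {b} → b ≤ 1 → Inj (far b)
    far-inj {b} b≤1 {t} {u} e =
      toℕ-injective (ℕ.+-cancelˡ-≡ b _ _ (offset-inj (offset<k b≤1 t) (offset<k b≤1 u) (cong proj₁ e)))

    far-symbol-inj : ∀ {b} → b ≤ 1 → Inj (far-symbol b)
    far-symbol-inj {b} b≤1 {t} {u} e = toℕ-injective (ℕ.*-cancelˡ-≡ _ _ 2 (ℕ.+-cancelˡ-≡ b _ _
      (offset-inj (b+2t<k b≤1 t) (b+2t<k b≤1 u) (cong proj₁ e))))

    -- At level 0 the diagonal only has residues below m ≤ q, while q + x lies between q and 2q and
    -- does not wrap around.
    diag≢offset : ∀ i {x} → x ≤ q → diag i ≢ ([ q + x ] , false)
    diag≢offset i {x} x≤q e with m ≤? toℕ i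
    ... | yes m≤i = case trans (sym (dec-true (m ≤? toℕ i) m≤i)) (cong proj₂ e) of λ ()
    ... | no m≰i = m≰i (≤-trans m≤q (≤-trans (m≤m+n q x) (ℕ.≤-reflexive
            (sym (trans (cong (toℕ ∘ proj₁) e) (toℕ-[]-small (s≤s (ℕ.+-monoʳ-≤ q x≤q))))))))

    diag≢far : ∀ {b} → b ≤ 1 → ∀ i t → diag i ≢ far b t
    diag≢far b≤1 i t = diag≢offset i (≤-trans (ℕ.+-monoˡ-≤ (toℕ t) b≤1) (t<q t))

    diag≢near : ∀ i t → diag i ≢ near t
    diag≢near i t e with m ≤? toℕ i
    ... | yes m≤i = ℕ.<⇒≱ (toℕ<n t) (≤-trans m≤i (ℕ.≤-reflexive (trans (cong (toℕ ∘ proj₁) e) (toℕ-[]-small (t<k t)))))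
    ... | no m≰i = case trans (sym (dec-false (m ≤? toℕ i) m≰i)) (cong proj₂ e) of λ ()

    I : Set
    I = Fin k ⊎ (Fin m ⊎ Fin m)

    R C S : I → X
    R = [ diag , [ far b , near ]′ ]′
    C = [ diag , [ near , far b′ ]′ ]′
    S = [ (λ i → i ⊕ i , false) , [ far-symbol b , far-symbol b′ ]′ ]′

    R-inj : Inj R
    R-inj = [,]-inj diag-inj ([,]-inj (far-inj b≤1) near-inj (λ _ _ ()))
      λ { i (inj₁ t) → diag≢far b≤1 i t ; i (inj₂ t) → diag≢near i t }

    C-inj : Inj C
    C-inj = [,]-inj diag-inj ([,]-inj near-inj (far-inj b′≤1) (λ _ _ ()))
      λ { i (inj₁ t) → diag≢near i t ; i (inj₂ t) → diag≢far b′≤1 i t }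

    -- Diagonal symbols have level 0 and differ because doubling is injective. The others have level
    -- 1 and offsets below k, which `b≢b′` keeps apart between the two families.
    S-inj : Inj S
    S-inj = [,]-inj (λ e → double-inj (cong proj₁ e))
      ([,]-inj (far-symbol-inj b≤1) (far-symbol-inj b′≤1)
        λ t u e → b≢b′ (toℕ t) (toℕ u) (offset-inj (b+2t<k b≤1 t) (b+2t<k b′≤1 u) (cong proj₁ e)))
      λ { i (inj₁ t) () ; i (inj₂ t) () }

    switched-diag : ∀ i → switched i i ≡ false
    switched-diag i with i ≟ᶠ [ q + q ]
    ... | no _ = refl
    ... | yes refl = dec-false ([ q + q ] ≟ᶠ [ q ])
            (λ e → ℕ.m+1+n≢m q ([]-injective (ℕ.n<1+n (q + q)) q<k e))

    -- No chosen cell is switched: on the diagonal because q and 2q differ modulo k, elsewhere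
    -- because t < q makes column t differ from q and row t from 2q.
    R∙C≡S : ∀ x → R x ∙ C x ≡ S x
    R∙C≡S (inj₁ i) = cong (i ⊕ i ,_) (cong₂ _xor_ (switched-diag i) (xor-same (does (m ≤? toℕ i))))
    R∙C≡S (inj₂ (inj₁ t)) = cong₂ _,_
      (trans ([]-⊕ (q + (b + toℕ t)) (toℕ t)) (cong [_] (regroup q b (toℕ t))))
      (cong (_xor true) (switched-col [ q + (b + toℕ t) ]
        (λ e → <⇒≢ (t<q t) ([]-injective (t<k t) q<k e))))
      where
      regroup : ∀ q b t → q + (b + t) + t ≡ q + (b + 2 * t)
      regroup = solve-∀
    R∙C≡S (inj₂ (inj₂ t)) = cong₂ _,_
      (trans ([]-⊕ (toℕ t) (q + (b′ + toℕ t))) (cong [_] (regroup q b′ (toℕ t))))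
      (cong (_xor true) (switched-row [ q + (b′ + toℕ t) ]
        (λ e → <⇒≢ (<-≤-trans (t<q t) (m≤m+n q q)) ([]-injective (t<k t) (ℕ.n<1+n (q + q)) e))))
      where
      regroup : ∀ q b t → t + (q + (b + t)) ≡ q + (b + 2 * t)
      regroup = solve-∀

    R∙C-inj : Inj (λ x → R x ∙ C x)
    R∙C-inj {x} {y} e = S-inj (trans (sym (R∙C≡S x)) (trans e (R∙C≡S y)))

    covers : (i : Fin k) → (diag i ≡ (i , true)) ⊎ (∃[ t ] near t ≡ (i , true))
    covers i with m ≤? toℕ i
    ... | yes m≤i = inj₁ (cong (i ,_) (dec-true (m ≤? toℕ i) m≤i))
    ... | no m≰i = inj₂ (fromℕ< (ℕ.≰⇒> m≰i) ,
            cong (_, true) (trans (cong [_] (toℕ-fromℕ< (ℕ.≰⇒> m≰i))) ([]-toℕ i)))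

    meets : ∀ r c → (∃[ x ] (R x ≡ r ⊎ C x ≡ c ⊎ R x ∙ C x ≡ r ∙ c)) ⊎
                    (r ≡ ([ q + q ] , false) × c ≡ ([ q ] , false))
    meets (i , true) c with covers i
    ... | inj₁ e       = inj₁ (inj₁ i , inj₁ e)
    ... | inj₂ (t , e) = inj₁ (inj₂ (inj₂ t) , inj₁ e)
    meets (i , false) (j , true) with covers j
    ... | inj₁ e       = inj₁ (inj₁ j , inj₂ (inj₁ e))
    ... | inj₂ (t , e) = inj₁ (inj₂ (inj₁ t) , inj₂ (inj₁ e))
    meets (i , false) (j , false) = split (i ≟ᶠ [ q + q ]) (j ≟ᶠ [ q ])
      where
      -- An unswitched cell with both lines at level 0 has its symbol at level 0, and the diagonal
      -- carries all of those because doubling is onto.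
      unswitched : switched i j ≡ false → ∃[ x ] R x ∙ C x ≡ (i , false) ∙ (j , false)
      unswitched s = case double-surj (i ⊕ j) of λ { (h , e) →
        inj₁ h , trans (R∙C≡S (inj₁ h)) (cong₂ _,_ e (sym (cong (_xor false) s))) }
      symbol : switched i j ≡ false → ∃[ x ] (R x ≡ (i , false) ⊎ C x ≡ (j , false) ⊎ R x ∙ C x ≡ (i , false) ∙ (j , false))
      symbol s = let (x , e) = unswitched s in x , inj₂ (inj₂ e)
      split : Dec (i ≡ [ q + q ]) → Dec (j ≡ [ q ]) → _
      split (yes i≡) (yes j≡) = inj₂ (cong (_, false) i≡ , cong (_, false) j≡)
      split (yes i≡) (no j≢)  = inj₁ (symbol (switched-col i j≢))
      split (no i≢)  _        = inj₁ (symbol (switched-row j i≢))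

    index : Fin (k + (m + m)) ↔ I
    index = (↔-id (Fin k) ⊎-↔ +↔⊎) ↔-∘ +↔⊎

  has-even-excess : ∀ {m} → suc m ≤ q → HasMaximalPartialTransversalOfLength L (k + (suc m + suc m))
  has-even-excess {m} m<q = realise index R C R-inj C-inj R∙C-inj λ r c → case meets r c of λ
    { (inj₁ met) → met
    -- The `far` columns have offset 0 here and start at q, so t = 0 already uses the column of the
    -- switched cell.
    ; (inj₂ (_ , refl)) → inj₂ (inj₂ zero) , inj₂ (inj₁ (cong (λ x → [ x ] , false) (+-identityʳ q))) }
    where open Staircase (suc m) 1 0 m<q (s≤s z≤n) z≤n (λ t u e → ℕ.even≢odd u t (sym e))

  -- Now the `far` rows q + t end before 2q and the `far` columns q + 1 + t start after q, so both
  -- lines of the switched cell are free. Its symbol (3q, 1) has offset 2q, beyond all staircase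
  -- symbols.
  has-odd-excess : ∀ {m} → m ≤ q → HasMaximalPartialTransversalOfLength L (k + (m + m) + 1)
  has-odd-excess {m} m≤q = realise ((index ⊎-↔ 1↔⊤) ↔-∘ +↔⊎) R⁺ C⁺
    ([,]-inj R-inj (λ _ → refl) (λ x _ → R≢ x))
    ([,]-inj C-inj (λ _ → refl) (λ x _ → C≢ x))
    (λ {x} {y} e → S⁺-inj (trans (sym (R⁺∙C⁺≡S⁺ x)) (trans e (R⁺∙C⁺≡S⁺ y))))
    λ r c → case meets r c of λ
      { (inj₁ (x , met)) → inj₁ x , met
      ; (inj₂ (refl , _)) → inj₂ tt , inj₁ refl }
    where
    open Staircase m 0 1 m≤q z≤n (s≤s z≤n) ℕ.even≢odd
    cell-row cell-col cell-symbol : X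
    cell-row    = [ q + q ] , false
    cell-col    = [ q ] , false
    cell-symbol = [ q + 2 * q ] , true
    R⁺ C⁺ S⁺ : I ⊎ ⊤ → X
    R⁺ = [ R , (λ _ → cell-row) ]′
    C⁺ = [ C , (λ _ → cell-col) ]′
    S⁺ = [ S , (λ _ → cell-symbol) ]′
    q+0 : cell-col ≡ ([ q + 0 ] , false)
    q+0 = cong (λ x → [ x ] , false) (sym (+-identityʳ q))
    R≢ : ∀ x → R x ≢ cell-row
    R≢ (inj₁ i)        e = diag≢offset i ℕ.≤-refl e
    R≢ (inj₂ (inj₁ t)) e = <⇒≢ (t<q t) (offset-inj (t<k t) q<k (cong proj₁ e))
    R≢ (inj₂ (inj₂ t)) ()
    C≢ : ∀ x → C x ≢ cell-col
    C≢ (inj₁ i)        e = diag≢offset i z≤n (trans e q+0)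
    C≢ (inj₂ (inj₁ t)) ()
    C≢ (inj₂ (inj₂ t)) e = case offset-inj (offset<k (s≤s z≤n) t) (s≤s z≤n) (cong proj₁ (trans e q+0)) of λ ()
    S≢ : ∀ x → S x ≢ cell-symbol
    S≢ (inj₁ i)        ()
    S≢ (inj₂ (inj₁ t)) e = <⇒≢ (b+2t<2q z≤n t) (offset-inj (b+2t<k z≤n t) 2q<k (cong proj₁ e))
    S≢ (inj₂ (inj₂ t)) e = <⇒≢ (b+2t<2q (s≤s z≤n) t) (offset-inj (b+2t<k (s≤s z≤n) t) 2q<k (cong proj₁ e))
    S⁺-inj : Inj S⁺
    S⁺-inj = [,]-inj S-inj (λ _ → refl) (λ x _ → S≢ x)
    R⁺∙C⁺≡S⁺ : ∀ x → R⁺ x ∙ C⁺ x ≡ S⁺ x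
    R⁺∙C⁺≡S⁺ (inj₁ x) = R∙C≡S x
    R⁺∙C⁺≡S⁺ (inj₂ _) = cong₂ _,_
      (trans ([]-⊕ (q + q) q) (cong [_] (regroup q)))
      (cong (_xor false) switched-cell)
      where
      regroup : ∀ q → q + q + q ≡ q + 2 * q
      regroup = solve-∀

  -- All lengths above k

  parity : ∀ x → (∃[ m ] x ≡ m + m) ⊎ (∃[ m ] x ≡ m + m + 1)
  parity zero = inj₁ (0 , refl)
  parity (suc x) with parity x
  ... | inj₁ (m , refl) = inj₂ (m , +-comm 1 (m + m))
  ... | inj₂ (m , refl) = inj₁ (suc m , cong suc (trans (+-assoc m m 1) (cong (m +_) (+-comm m 1))))

  half-≤ : ∀ {m} → m + m ≤ k → m ≤ q
  half-≤ {m} 2m≤k with m ≤? q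
  ... | yes m≤q = m≤q
  ... | no m≰q = contradiction
          (≤-trans (ℕ.+-mono-≤ (ℕ.≰⇒> m≰q) (ℕ.≰⇒> m≰q)) 2m≤k)
          (ℕ.<⇒≱ (s≤s (s≤s (ℕ.≤-reflexive (sym (+-suc p (suc p)))))))

  has-excess : ∀ x → suc x ≤ k → HasMaximalPartialTransversalOfLength L (k + suc x)
  has-excess x x<k with parity (suc x)
  -- An even excess is positive here, which supplies the m ≥ 1 needed to block the switched cell.
  ... | inj₁ (suc m , refl) = has-even-excess (half-≤ {suc m} x<k)
  ... | inj₂ (m , e) rewrite e = subst (HasMaximalPartialTransversalOfLength L) (+-assoc k (m + m) 1)
          (has-odd-excess {m} (half-≤ {m} (≤-trans (m≤m+n (m + m) 1) x<k)))

  half≡k : ⌈ n /2⌉ ≡ k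
  half≡k = trans (cong ⌈_/2⌉ n≡k+k) (sym (n≡⌈n+n/2⌉ k))

  near-omniversal : IsNearOmniversal L
  near-omniversal = k , ℕ.≤-reflexive half≡k , subst (k ≤_) (sym n≡k+k) (m≤m+n k k) , no-half-maximal , unique
    where
    unique : ∀ ℓ → ⌈ n /2⌉ ≤ ℓ → ℓ ≤ n → ¬ HasMaximalPartialTransversalOfLength L ℓ → ℓ ≡ k
    unique ℓ lower upper missing with ℓ ∸ k | m+[n∸m]≡n (subst (_≤ ℓ) half≡k lower)
    ... | zero  | refl = +-identityʳ k
    ... | suc x | refl = contradiction (has-excess x (ℕ.+-cancelˡ-≤ k _ _ (subst (k + suc x ≤_) n≡k+k upper))) missing

-- Order 2

module Order2 where

  L : Square 2
  L zero    c = c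
  L (suc _) zero    = suc zero
  L (suc _) (suc _) = zero

  L-injʳ : ∀ r → Inj (L r)
  L-injʳ zero       e = e
  L-injʳ (suc zero) {zero}     {zero}     e = refl
  L-injʳ (suc zero) {suc zero} {suc zero} e = refl

  L-injˡ : ∀ c → Inj (flip L c)
  L-injˡ zero       {zero}     {zero}     e = refl
  L-injˡ zero       {suc zero} {suc zero} e = refl
  L-injˡ (suc zero) {zero}     {zero}     e = refl
  L-injˡ (suc zero) {suc zero} {suc zero} e = refl

  -- Changing both coordinates adds 1 + 1 = 0 in ℤ₂. This excludes length 2.
  opposite : ∀ r c r′ c′ → r ≢ r′ → c ≢ c′ → L r c ≡ L r′ c′
  opposite zero       c          zero       c′         r≢ c≢ = contradiction refl r≢
  opposite (suc zero) c          (suc zero) c′         r≢ c≢ = contradiction refl r≢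
  opposite r          zero       r′         zero       r≢ c≢ = contradiction refl c≢
  opposite r          (suc zero) r′         (suc zero) r≢ c≢ = contradiction refl c≢
  opposite zero       zero       (suc zero) (suc zero) _ _ = refl
  opposite zero       (suc zero) (suc zero) zero       _ _ = refl
  opposite (suc zero) zero       zero       (suc zero) _ _ = refl
  opposite (suc zero) (suc zero) zero       zero       _ _ = refl

  no-transversal : ¬ HasMaximalPartialTransversalOfLength L 2
  no-transversal (f , (rows , cols , symbols) , _) =
    0≢1 (symbols _ _ (opposite _ _ _ _ (0≢1 ∘ rows _ _) (0≢1 ∘ cols _ _)))
    where
    0≢1 : _≢_ {A = Fin 2} zero (suc zero)
    0≢1 ()

  has-single : HasMaximalPartialTransversalOfLength L 1
  has-single = (λ _ → zero , zero) , meets⇒maximal {L = L} {ℓ = 1}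
    ((λ { zero zero _ → refl }) , (λ { zero zero _ → refl }) , (λ { zero zero _ → refl }))
    λ { zero       c          → zero , inj₁ refl
      ; (suc zero) zero       → zero , inj₂ (inj₁ refl)
      ; (suc zero) (suc zero) → zero , inj₂ (inj₂ refl) }

  near-omniversal : IsNearOmniversal L
  -- Here the missing length is n itself; in the switched squares it is n / 2.
  near-omniversal = 2 , s≤s z≤n , s≤s (s≤s z≤n) , no-transversal , λ
    { 1 _ _ missing → contradiction has-single missing
    ; 2 _ _ _       → refl
    ; (suc (suc (suc _))) _ (s≤s (s≤s ())) _ }

theorem1p4 : (n : ℕ) → 0 < n → n % 4 ≡ 2 →
    Σ[ L ∈ Square n ] (IsLatinSquare L × IsNearOmniversal L)
theorem1p4 n _ n%4≡2 = subst (λ n → Σ[ L ∈ Square n ] (IsLatinSquare L × IsNearOmniversal L)) (sym n≡) (square (n / 4))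
  where
  square : ∀ q → Σ[ L ∈ Square (suc (q + q) * 2) ] (IsLatinSquare L × IsNearOmniversal L)
  square zero    = L , cancellative⇒latin L L-injʳ L-injˡ , near-omniversal
    where open Order2
  square (suc p) = L , cancellative⇒latin L L-injʳ L-injˡ , near-omniversal
    where open Switched p
  regroup : ∀ q → 2 + q * 4 ≡ suc (q + q) * 2
  regroup = solve-∀
  n≡ : n ≡ suc (n / 4 + n / 4) * 2
  n≡ = trans (m≡m%n+[m/n]*n n 4) (trans (cong (_+ n / 4 * 4) n%4≡2) (regroup (n / 4)))
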